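{- For all $n\ge1$, $k\ge1$ and every $\pi\in\mathbf{C}(n,k)$, the list $\mathcal{C}(\pi)$ contains every element of $\mathbf{C}(n,k)$ exactly once (so it has length $k^n n!$), each entry after the first is obtained from the preceding entry by a flip, and the first entry is obtained from the last entry by a flip of length $n$ (i.e. if $L$ is the last entry then $\mathrm{flip}_n(L)=\pi$).
   Context: Fix integers $n\ge1$, $k\ge1$. A $k$-coloured permutation of $\{1,\dots,n\}$ is a sequence $\pi=p_1p_2\cdots p_n$ with $p_i=v_i^{c_i}$, where $v_1\cdots v_n$ is a permutation of $\{1,\dots,n\}$ and each $c_i\in\{0,\dots,k-1\}$; the set of these is $\mathbf{C}(n,k)$. A pre-perm is a prefix $p_1\cdots p_j$ ($1\le j\le n$) of some element of $\mathbf{C}(n,k)$. For $p=v^c$ and integer $s$, $p^{+s}=v^{(c+s)\bmod k}$; for $\mathbf{p}=p_1\cdots p_j$, $\mathbf{p}^{+s}=p_1^{+s}\cdots p_j^{+s}$. For $1\le i\le n$, $\mathrm{flip}_i(p_1\cdots p_n)=p_i^{+1}p_{i-1}^{+1}\cdots p_1^{+1}p_{i+1}\cdots p_n$. For a pre-perm $\mathbf{p}$ of length $j$, $\rho(\mathbf{p})=r_1\cdots r_m$ ($m=kj$) is the concatenation $\mathbf{p}^{+(k-1)}\mathbf{p}^{+(k-2)}\cdots\mathbf{p}^{+0}$ viewed circularly (indices mod $m$), and $\rho(\mathbf{p})_i=r_{i-j+1}\cdots r_{i-1}$ (length $j-1$, indices mod $m$). The list $\mathcal{C}(\mathbf{p})$: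 if $j=1$, $\mathcal{C}(p_1)=p_1^{+0},p_1^{+1},\dots,p_1^{+(k-1)}$; if $j\ge2$, $\mathcal{C}(\mathbf{p})$ is the concatenation for $i=m,m-1,\dots,1$ of the lists obtained from $\mathcal{C}(\rho(\mathbf{p})_i)$ by appending $r_i$ to every entry. -}

module Defs where

open import Data.Fin.Base using (Fin; toℕ; fromℕ<)
open import Data.Integer.Base using (ℤ; +_; _%ℕ_) renaming (_+_ to _+ℤ_; _-_ to _-ℤ_)
open import Data.Integer.DivMod using (n%ℕd<d)
open import Data.List.Base using (List; map; concatMap; upTo; downFrom)
open import Data.Nat.Base using (ℕ; suc; _+_; _*_; _∸_; _≤_; NonZero)
open import Data.Nat.Properties using (m+[n∸m]≡n; m*n≢0)
open import Data.Product.Base using (_×_; _,_; proj₁; ∃-syntax)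
open import Data.Vec.Base as Vec using (Vec; _++_; _∷ʳ_; lookup; tabulate; concat; reverse; take; drop; cast)
open import Function.Definitions using (Bijective)
open import Relation.Binary.PropositionalEquality using (_≡_; sym)

-- The residue of an integer, as an element of Fin d.
residue : ℤ → (d : ℕ) .{{_ : NonZero d}} → Fin d
residue i d = fromℕ< (n%ℕd<d i d)

-- r_i for a word r = r_1 ⋯ r_m viewed circularly.  The index i is 1-based and
-- read modulo m, whereas Vec positions are 0-based, hence i - 1.
circular : ∀ {A : Set} {m} .{{_ : NonZero m}} → Vec A m → ℤ → A
circular {m = m} r i = lookup r (residue (i -ℤ + 1) m)

module Coloured (n k : ℕ) .{{_ : NonZero k}} where

  -- v^c is the pair (v , c).  The values 1, …, n are represented by the
  -- elements 0, …, n-1 of Fin n.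
  Symbol : Set
  Symbol = Fin n × Fin k

  -- Pre-perms of length j are particular elements of Word j; the operations
  -- below make no use of the distinctness of the values.
  Word : ℕ → Set
  Word j = Vec Symbol j

  IsColouredPerm : Word n → Set
  IsColouredPerm π = Bijective _≡_ _≡_ (lookup (Vec.map proj₁ π))

  infixl 8 _⁺ˢ_ _⁺_

  _⁺ˢ_ : Symbol → ℤ → Symbol
  (v , c) ⁺ˢ s = v , residue (+ toℕ c +ℤ s) k

  _⁺_ : ∀ {j} → Word j → ℤ → Word j
  p ⁺ s = Vec.map (_⁺ˢ s) p

  -- The casts only identify the lengths i + (j ∸ i) and j.
  flip : ∀ {j} (i : ℕ) → i ≤ j → Word j → Word j
  flip {j} i i≤j p = cast (m+[n∸m]≡n i≤j) (reverse (take i p′) ⁺ (+ 1) ++ drop i p′)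
    where
    p′ : Word (i + (j ∸ i))
    p′ = cast (sym (m+[n∸m]≡n i≤j)) p

  FlipStep : ∀ {j} → Word j → Word j → Set
  FlipStep {j} p q = ∃[ i ] 1 ≤ i × (∃[ i≤j ] q ≡ flip {j} i i≤j p)

  -- p^{+(k-1)} p^{+(k-2)} ⋯ p^{+0}
  ρ : ∀ {j} → Word j → Word (k * j)
  ρ p = concat (tabulate λ (a : Fin k) → p ⁺ (+ (k ∸ suc (toℕ a))))

  -- r_i, where r = ρ(p)
  ρ-symbol : ∀ {j} .{{_ : NonZero j}} → Word j → ℤ → Symbol
  ρ-symbol {j} p i = circular {{m*n≢0 k j}} (ρ p) i

  -- ρ(p)_i = r_{i-j+1} ⋯ r_{i-1}, for p of length j = suc l
  ρ-window : ∀ {l} → Word (suc l) → ℤ → Word l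
  ρ-window {l} p i = tabulate λ (t : Fin l) → ρ-symbol p (i -ℤ + suc l +ℤ + 1 +ℤ + toℕ t)

  -- map suc (downFrom m) lists the indices m, m-1, …, 1.
  𝒞 : ∀ {j} .{{_ : NonZero j}} → Word j → List (Word j)
  𝒞 {1}                 p = map (λ s → p ⁺ (+ s)) (upTo k)
  𝒞 {j@(suc l@(suc _))} p =
    concatMap (λ i → map (_∷ʳ ρ-symbol p (+ i)) (𝒞 {l} (ρ-window p (+ i))))
              (map suc (downFrom (k * j)))

{-# OPTIONS --safe #-}

-- Read circularly, the word r = ρ(p) satisfies r_{1+b+qj} = p_{b+1}^{−1−q} for all
-- integers q and 0 ≤ b < j.  Hence r_{i−j} = r_i^{+1}, and the factor r_{i−j+1} ⋯ r_i
-- is p both for i = 0 and for i = m.  Inductively, 𝒞(w) runs by flips from w to the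
-- word that flips to w, so the block of r_i runs from r_{i−j+1} ⋯ r_{i−1} r_i to a
-- word whose full flip is r_i^{+1} r_{i−j+1} ⋯ r_{i−1} = r_{i−j} ⋯ r_{i−1}, the start of
-- the next block.  Every word with the values of p occurs exactly once, because its
-- last symbol is r_i for a unique i, and the window before r_i carries the remaining
-- values.
module Submission where

open import Defs
open import Data.Empty using (⊥-elim)
open import Data.Fin.Base as Fin using (Fin; toℕ; fromℕ; fromℕ<; combine; inject₁)
open import Data.Fin.Properties using (toℕ<n; toℕ-fromℕ<; toℕ-injective; toℕ-combine; toℕ-inject₁; toℕ-fromℕ; combine-surjective; suc-injective)
open import Data.Integer.Base using (ℤ; +_; -_; _+_; _-_; _/ℕ_; _%ℕ_; ∣_∣) renaming (_*_ to _·_)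
open import Data.Integer.DivMod using (n%ℕd<d; a≡a%ℕn+[a/ℕn]*n)
open import Data.Integer.Properties using (m-n≡m⊖n; abs-*; ∣m⊝n∣≤m⊔n; ∣i∣≡0⇒i≡0; i-j≡0⇒i≡j; +-injective; pos-*; *-identityˡ; +-assoc)
open import Data.Integer.Tactic.RingSolver using (solve-∀)
open import Data.List.Base as List using (List; []; _∷_; _++_; length; head; last; map; concatMap; applyUpTo; upTo; downFrom)
open import Data.List.Membership.Propositional using (_∈_; find; lose)
open import Data.List.Membership.Propositional.Properties using (∈-map⁺; ∈-map⁻; ∈-concatMap⁺; ∈-concatMap⁻; ∈-upTo⁺; ∈-downFrom⁺)
open import Data.List.Membership.Propositional.Properties.WithK using (unique∧set⇒bag)
import Data.List.Properties as List
open import Data.List.Relation.Binary.BagAndSetEquality using (∼bag⇒↭)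
open import Data.List.Relation.Binary.Disjoint.Propositional using (Disjoint)
open import Data.List.Relation.Binary.Permutation.Propositional using (_↭_; ↭-refl; ↭-reflexive; ↭-sym; ↭-trans; ↭⇒↭ₛ; prep)
open import Data.List.Relation.Binary.Permutation.Propositional.Properties using (∈-resp-↭; ∷↭∷ʳ; drop-∷; ↭-singleton-inv)
open import Data.List.Relation.Binary.Permutation.Setoid.Properties using (Unique-resp-↭)
import Data.List.Relation.Unary.All.Properties as All
open import Data.List.Relation.Unary.AllPairs using ([]; _∷_; tail)
import Data.List.Relation.Unary.AllPairs.Properties as AllPairs
open import Data.List.Relation.Unary.Any using (here)
open import Data.List.Relation.Unary.Linked using (Linked; [-]; _∷_)
open import Data.List.Relation.Unary.Unique.Propositional using (Unique)
import Data.List.Relation.Unary.Unique.Propositional.Properties as Unique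
open import Data.Maybe.Base using (just)
open import Data.Nat.Base as ℕ using (ℕ; zero; suc; _*_; _^_; _!; _≤_; NonZero; s≤s; z≤n)
open import Data.Nat.Divisibility using (_∣_; divides; >⇒∤)
open import Data.Nat.Properties as ℕ using (≤-refl)
import Data.Nat.Tactic.RingSolver as ℕ
open import Data.Product.Base using (_×_; _,_; proj₁; proj₂; ∃-syntax)
open import Data.Vec.Base as Vec using (Vec; []; _∷_; _∷ʳ_; toList; tabulate; lookup; reverse)
open import Data.Vec.Membership.Propositional.Properties using (∈-lookup; ∈-toList⁺; ∈-toList⁻)
open import Data.Vec.Properties
  using (lookup∘tabulate; lookup-concat; lookup-map; tabulate-cong; tabulate∘lookup; ∷-injective; ∷ʳ-injective; ∷ʳ-injectiveˡ;
         toList-injective; toList-cast; toList-++; toList-map; toList-reverse; toList-∷ʳ; length-toList;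
         cast-is-id; map-∷ʳ; map-∘; map-cong; map-id; reverse-∷; reverse-involutive)
import Data.Vec.Relation.Unary.Any as VecAny
open import Data.Vec.Relation.Unary.Any.Properties using (lookup-index)
open import Function.Base using (_∘_; id)
open import Function.Bundles using (_⇔_; mk⇔)
open import Function.Definitions using (Injective)
open import Relation.Binary.PropositionalEquality using (_≡_; refl; sym; trans; cong; cong₂; subst; setoid; module ≡-Reasoning)

open ≡-Reasoning

-- Residues of integers modulo `d`.

small-multiple : ∀ {d m} → m ℕ.< d → d ∣ m → m ≡ 0
small-multiple {m = zero}  _   _   = refl
small-multiple {m = suc _} m<d d∣m = ⊥-elim (>⇒∤ m<d d∣m)

module _ (d : ℕ) .{{_ : NonZero d}} where

  residue-split : ∀ i → i ≡ + toℕ (residue i d) + (i /ℕ d) · + d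
  residue-split i = begin
    i                                       ≡⟨ a≡a%ℕn+[a/ℕn]*n i d ⟩
    + (i %ℕ d) + (i /ℕ d) · + d             ≡⟨ cong (λ r → + r + (i /ℕ d) · + d) (toℕ-fromℕ< (n%ℕd<d i d)) ⟨
    + toℕ (residue i d) + (i /ℕ d) · + d    ∎

  private
    difference : ∀ r x q q′ e → r + q′ · e ≡ x + q · e → r - x ≡ (q - q′) · e
    difference r x q q′ e eq = begin
      r - x                       ≡⟨ expand r x (q′ · e) ⟩
      (r + q′ · e) - x - q′ · e   ≡⟨ cong (λ y → y - x - q′ · e) eq ⟩
      (x + q · e) - x - q′ · e    ≡⟨ collect x q q′ e ⟩
      (q - q′) · e                ∎
      where
      expand : ∀ r x y → r - x ≡ (r + y) - x - y
      expand = solve-∀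
      collect : ∀ x q q′ e → (x + q · e) - x - q′ · e ≡ (q - q′) · e
      collect = solve-∀

  -- Both representatives lie in [0, d), so their difference has absolute value at most their
  -- maximum, which is below d. Being a multiple of d, it vanishes.
  residue-unique : ∀ {i} (x : Fin d) q → i ≡ + toℕ x + q · + d → residue i d ≡ x
  residue-unique {i} x q i≡ = toℕ-injective (+-injective (i-j≡0⇒i≡j (+ r) (+ toℕ x) (∣i∣≡0⇒i≡0 (small-multiple bound multiple))))
    where
    r : ℕ
    r = toℕ (residue i d)

    multiple : d ∣ ∣ + r - + toℕ x ∣
    multiple = divides ∣ q - i /ℕ d ∣ (trans
      (cong ∣_∣ (difference (+ r) (+ toℕ x) q (i /ℕ d) (+ d) (trans (sym (residue-split i)) i≡)))
      (abs-* (q - i /ℕ d) (+ d)))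

    bound : ∣ + r - + toℕ x ∣ ℕ.< d
    bound = subst (λ z → ∣ z ∣ ℕ.< d) (sym (m-n≡m⊖n r (toℕ x)))
      (ℕ.≤-<-trans (∣m⊝n∣≤m⊔n r (toℕ x)) (ℕ.⊔-lub (toℕ<n (residue i d)) (toℕ<n x)))

  residue-cong : ∀ {i} i′ q → i ≡ i′ + q · + d → residue i d ≡ residue i′ d
  residue-cong {i} i′ q i≡ = residue-unique (residue i′ d) (i′ /ℕ d + q) (begin
    i                                                     ≡⟨ i≡ ⟩
    i′ + q · + d                                          ≡⟨ cong (λ z → z + q · + d) (residue-split i′) ⟩
    + toℕ (residue i′ d) + i′ /ℕ d · + d + q · + d        ≡⟨ regroup (+ toℕ (residue i′ d)) (i′ /ℕ d) q (+ d) ⟩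
    + toℕ (residue i′ d) + (i′ /ℕ d + q) · + d            ∎)
    where
    regroup : ∀ x a b e → x + a · e + b · e ≡ x + (a + b) · e
    regroup = solve-∀

-- Auxiliary facts on vectors and lists.

tabulate-∷ʳ : ∀ {A : Set} {l} (f : Fin (suc l) → A) → tabulate f ≡ tabulate (f ∘ inject₁) ∷ʳ f (fromℕ l)
tabulate-∷ʳ {l = zero}  f = refl
tabulate-∷ʳ {l = suc l} f = cong (f Fin.zero ∷_) (tabulate-∷ʳ (f ∘ Fin.suc))

module _ {A : Set} where

  -- Passing to lists makes the casts inside `flip` disappear, so identities between flipped words
  -- are proved there and brought back.
  vec-≡ : ∀ {m} {xs ys : Vec A m} → toList xs ≡ toList ys → xs ≡ ys
  vec-≡ {xs = xs} {ys} eq = trans (sym (cast-is-id refl xs)) (toList-injective refl xs ys eq)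

  toList-take : ∀ i {m} (xs : Vec A (i ℕ.+ m)) → toList (Vec.take i xs) ≡ List.take i (toList xs)
  toList-take zero    xs       = refl
  toList-take (suc i) (x ∷ xs) = cong (x ∷_) (toList-take i xs)

  toList-drop : ∀ i {m} (xs : Vec A (i ℕ.+ m)) → toList (Vec.drop i xs) ≡ List.drop i (toList xs)
  toList-drop zero    xs       = refl
  toList-drop (suc i) (x ∷ xs) = toList-drop i xs

  take-++-≤ : ∀ {i} (xs {ys} : List A) → i ≤ length xs → List.take i (xs ++ ys) ≡ List.take i xs
  take-++-≤ {zero}  xs       i≤       = refl
  take-++-≤ {suc i} (x ∷ xs) (s≤s i≤) = cong (x ∷_) (take-++-≤ xs i≤)

  drop-++-≤ : ∀ {i} (xs {ys} : List A) → i ≤ length xs → List.drop i (xs ++ ys) ≡ List.drop i xs ++ ys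
  drop-++-≤ {zero}  xs       i≤       = refl
  drop-++-≤ {suc i} (x ∷ xs) (s≤s i≤) = drop-++-≤ xs i≤

  -- `IsColouredPerm` speaks of `lookup`, whereas the induction handles value lists up to
  -- permutation; this lemma and its converse translate between the two.
  lookup-injective⇒unique : ∀ {m} (xs : Vec A m) → Injective _≡_ _≡_ (lookup xs) → Unique (toList xs)
  lookup-injective⇒unique []       inj = []
  lookup-injective⇒unique (x ∷ xs) inj =
    All.¬Any⇒All¬ (toList xs) x∉xs ∷ lookup-injective⇒unique xs (λ eq → suc-injective (inj eq))
    where
    x∉xs : x ∈ toList xs → _
    x∉xs x∈ with () ← inj {Fin.zero} {Fin.suc (VecAny.index (∈-toList⁻ x∈))} (lookup-index (∈-toList⁻ x∈))

  unique⇒lookup-injective : ∀ {m} (xs : Vec A m) → Unique (toList xs) → Injective _≡_ _≡_ (lookup xs)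
  unique⇒lookup-injective (x ∷ xs) _             {Fin.zero}  {Fin.zero}  eq = refl
  unique⇒lookup-injective (x ∷ xs) u             {Fin.zero}  {Fin.suc j} eq =
    ⊥-elim (Unique.Unique[x∷xs]⇒x∉xs u (subst (_∈ toList xs) (sym eq) (∈-toList⁺ (∈-lookup j xs))))
  unique⇒lookup-injective (x ∷ xs) u             {Fin.suc i} {Fin.zero}  eq =
    ⊥-elim (Unique.Unique[x∷xs]⇒x∉xs u (subst (_∈ toList xs) eq (∈-toList⁺ (∈-lookup i xs))))
  unique⇒lookup-injective (x ∷ xs) (_ ∷ u)       {Fin.suc i} {Fin.suc j} eq =
    cong Fin.suc (unique⇒lookup-injective xs u eq)

length-concatMap-const : ∀ {A B : Set} (f : A → List B) {c} → (∀ x → length (f x) ≡ c) →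
                         ∀ xs → length (concatMap f xs) ≡ length xs * c
length-concatMap-const f     f≡c []       = refl
length-concatMap-const f {c} f≡c (x ∷ xs) =
  trans (List.length-++ (f x)) (cong₂ ℕ._+_ (f≡c x) (length-concatMap-const f f≡c xs))

-- Paths with prescribed endpoints.

-- A nonempty `Linked` list with both ends in its type: joining two of them then takes a single step
-- from the end of one to the start of the other.
data Path {A : Set} (R : A → A → Set) : A → List A → A → Set where
  [-] : ∀ {a} → Path R a (a ∷ []) a
  _∷_ : ∀ {a b c xs} → R a b → Path R b xs c → Path R a (a ∷ xs) c

module _ {A : Set} {R : A → A → Set} where

  path-head : ∀ {a b xs} → Path R a xs b → head xs ≡ just a
  path-head [-]     = refl
  path-head (_ ∷ _) = refl

  path-last : ∀ {a b xs} → Path R a xs b → last xs ≡ just b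
  path-last [-]               = refl
  path-last (_ ∷ [-])         = refl
  path-last (_ ∷ p@(_ ∷ _))   = path-last p

  path-linked : ∀ {a b xs} → Path R a xs b → Linked R xs
  path-linked [-]             = [-]
  path-linked (r ∷ [-])       = r ∷ [-]
  path-linked (r ∷ p@(_ ∷ _)) = r ∷ path-linked p

  path-endpoints : ∀ {a b a′ b′ xs} → a ≡ a′ → b ≡ b′ → Path R a xs b → Path R a′ xs b′
  path-endpoints refl refl p = p

  path-++ : ∀ {a b c d xs ys} → Path R a xs b → R b c → Path R c ys d → Path R a (xs ++ ys) d
  path-++ [-]     r q = r ∷ q
  path-++ (s ∷ p) r q = s ∷ path-++ p r q

  path-map : ∀ {B : Set} {S : B → B → Set} (f : A → B) → (∀ {x y} → R x y → S (f x) (f y)) →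
             ∀ {a b xs} → Path R a xs b → Path S (f a) (map f xs) (f b)
  path-map f f-mono [-]     = [-]
  path-map f f-mono (r ∷ p) = f-mono r ∷ path-map f f-mono p

  path-applyUpTo : ∀ {B : Set} (f : B → A) (g : ℕ → B) → (∀ i → R (f (g i)) (f (g (suc i)))) →
                   ∀ m → Path R (f (g 0)) (map f (applyUpTo g (suc m))) (f (g m))
  path-applyUpTo f g step zero    = [-]
  path-applyUpTo f g step (suc m) = step 0 ∷ path-applyUpTo f (g ∘ suc) (step ∘ suc) m

  -- The blocks come in decreasing order, hence the joining step leads from the end of block i + 1
  -- to the start of block i.
  path-downFrom : ∀ (block : ℕ → List A) (start end : ℕ → A) →
                  (∀ i → Path R (start i) (block i) (end i)) →
                  (∀ i → R (end (suc i)) (start i)) →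
                  ∀ m .{{_ : NonZero m}} → Path R (start m) (concatMap block (map suc (downFrom m))) (end 1)
  path-downFrom block start end paths step 1 =
    subst (λ xs → Path R (start 1) xs (end 1)) (sym (List.++-identityʳ (block 1))) (paths 1)
  path-downFrom block start end paths step (suc m@(suc _)) =
    path-++ (paths (suc m)) (step m) (path-downFrom block start end paths step m)

module _ (n k : ℕ) .{{_ : NonZero k}} where
  open Coloured n k

  -- Colour shifts modulo `k`.

  ⁺ˢ-cong : ∀ (x : Symbol) {s} t q → s ≡ t + q · + k → x ⁺ˢ s ≡ x ⁺ˢ t
  ⁺ˢ-cong (v , c) {s} t q s≡ = cong (v ,_) (residue-cong k (+ toℕ c + t) q (begin
    + toℕ c + s                ≡⟨ cong (λ z → + toℕ c + z) s≡ ⟩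
    + toℕ c + (t + q · + k)    ≡⟨ +-assoc (+ toℕ c) t (q · + k) ⟨
    + toℕ c + t + q · + k      ∎))

  ⁺ˢ-0 : ∀ (x : Symbol) → x ⁺ˢ (+ 0) ≡ x
  ⁺ˢ-0 (v , c) = cong (v ,_) (residue-unique k c (+ 0) refl)

  ⁺ˢ-⁺ˢ : ∀ (x : Symbol) s t → x ⁺ˢ s ⁺ˢ t ≡ x ⁺ˢ (s + t)
  ⁺ˢ-⁺ˢ (v , c) s t = cong (v ,_) (sym (residue-cong k (+ toℕ (residue y k) + t) (y /ℕ k) (begin
    + toℕ c + (s + t)                                   ≡⟨ +-assoc (+ toℕ c) s t ⟨
    y + t                                               ≡⟨ cong (_+ t) (residue-split k y) ⟩
    + toℕ (residue y k) + y /ℕ k · + k + t              ≡⟨ swap (+ toℕ (residue y k)) (y /ℕ k · + k) t ⟩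
    + toℕ (residue y k) + t + y /ℕ k · + k              ∎)))
    where
    y : ℤ
    y = + toℕ c + s
    swap : ∀ x y z → x + y + z ≡ x + z + y
    swap = solve-∀

  ⁺ˢ-connects : ∀ (x y : Symbol) → proj₁ x ≡ proj₁ y → ∃[ s ] y ≡ x ⁺ˢ s
  ⁺ˢ-connects (v , c) (.v , c′) refl = + toℕ c′ - + toℕ c , cong (v ,_) (sym (residue-unique k c′ (+ 0) (cancel (+ toℕ c) (+ toℕ c′))))
    where
    cancel : ∀ x y → x + (y - x) ≡ y + + 0
    cancel = solve-∀

  -- Subtracting the colour of `x` from the colour of the shifted symbol recovers the shift modulo
  -- k.
  ⁺ˢ-injective : ∀ (x : Symbol) s t → x ⁺ˢ s ≡ x ⁺ˢ t → residue s k ≡ residue t k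
  ⁺ˢ-injective x s t eq = trans (sym (recover s)) (trans (cong (λ y → residue (+ toℕ (proj₂ y) - c) k) eq) (recover t))
    where
    c : ℤ
    c = + toℕ (proj₂ x)
    shuffle : ∀ c r q e → r + q · e - c ≡ (r - c) + q · e
    shuffle = solve-∀
    cancel : ∀ c u → u ≡ c + u - c
    cancel = solve-∀
    recover : ∀ u → residue (+ toℕ (residue (c + u) k) - c) k ≡ residue u k
    recover u = sym (residue-cong k (+ toℕ (residue (c + u) k) - c) ((c + u) /ℕ k) (begin
      u                                                             ≡⟨ cancel c u ⟩
      c + u - c                                                     ≡⟨ cong (_- c) (residue-split k (c + u)) ⟩
      + toℕ (residue (c + u) k) + (c + u) /ℕ k · + k - c            ≡⟨ shuffle c (+ toℕ (residue (c + u) k)) ((c + u) /ℕ k) (+ k) ⟩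
      (+ toℕ (residue (c + u) k) - c) + (c + u) /ℕ k · + k          ∎))

  -- The circular word ρ(p) and its factors.

  -- Copy `a` in ρ(p) is shifted by k - 1 - a. Modulo k this is -1 - a, an expression that still
  -- makes sense when `a` becomes an arbitrary integer.
  pos-∸-suc : ∀ (a : Fin k) → + (k ℕ.∸ suc (toℕ a)) ≡ (- + 1 - + toℕ a) + + 1 · + k
  pos-∸-suc a = begin
    + (k ℕ.∸ suc (toℕ a))                                               ≡⟨ cancel (+ (k ℕ.∸ suc (toℕ a))) (+ toℕ a) ⟩
    (- + 1 - + toℕ a) + + 1 · + (k ℕ.∸ suc (toℕ a) ℕ.+ suc (toℕ a))    ≡⟨ cong (λ z → (- + 1 - + toℕ a) + + 1 · + z) (ℕ.m∸n+n≡m (toℕ<n a)) ⟩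
    (- + 1 - + toℕ a) + + 1 · + k                                       ∎
    where
    cancel : ∀ x a → x ≡ (- + 1 - a) + + 1 · (x + (+ 1 + a))
    cancel = solve-∀

  lookup-ρ : ∀ {j} (p : Word j) a b → lookup (ρ p) (combine a b) ≡ lookup p b ⁺ˢ (- + 1 - + toℕ a)
  lookup-ρ {j} p a b = begin
    lookup (ρ p) (combine a b)                             ≡⟨ lookup-concat (tabulate copy) a b ⟩
    lookup (lookup (tabulate copy) a) b                    ≡⟨ cong (λ w → lookup w b) (lookup∘tabulate copy a) ⟩
    lookup (copy a) b                                      ≡⟨ lookup-map b _ p ⟩
    lookup p b ⁺ˢ (+ (k ℕ.∸ suc (toℕ a)))                    ≡⟨ ⁺ˢ-cong (lookup p b) (- + 1 - + toℕ a) (+ 1) (pos-∸-suc a) ⟩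
    lookup p b ⁺ˢ (- + 1 - + toℕ a)                        ∎
    where
    copy : Fin k → Word j
    copy a = p ⁺ (+ (k ℕ.∸ suc (toℕ a)))

  -- Position 1 + b + qj lies in copy q mod k, and the shift -1 - q matters only modulo k. Since q
  -- is any integer, later index computations need no case distinction for wrapping around.
  ρ-symbol-≡ : ∀ {j} .{{_ : NonZero j}} (p : Word j) b q {i} → i ≡ + 1 + (+ toℕ b + q · + j) →
               ρ-symbol p i ≡ lookup p b ⁺ˢ (- + 1 - q)
  ρ-symbol-≡ {j} p b q {i} i≡ = begin
    ρ-symbol p i                           ≡⟨ cong (lookup (ρ p)) (residue-unique (k ℕ.* j) {{ℕ.m*n≢0 k j}} (combine a b) (q /ℕ k) index) ⟩
    lookup (ρ p) (combine a b)             ≡⟨ lookup-ρ p a b ⟩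
    lookup p b ⁺ˢ (- + 1 - + toℕ a)        ≡⟨ ⁺ˢ-cong (lookup p b) (- + 1 - q) (q /ℕ k) colour ⟩
    lookup p b ⁺ˢ (- + 1 - q)              ∎
    where
    a : Fin k
    a = residue q k

    cancel : ∀ b j a c k → + 1 + (b + (a + c · k) · j) - + 1 ≡ (j · a + b) + c · (k · j)
    cancel = solve-∀

    -- With q = a + (q / k) k, the 0-based index exceeds the position of symbol b in copy a by q / k
    -- full turns of length kj.
    index : i - + 1 ≡ + toℕ (combine a b) + q /ℕ k · + (k ℕ.* j)
    index = begin
      i - + 1                                                        ≡⟨ cong (λ z → z - + 1) i≡ ⟩
      + 1 + (+ toℕ b + q · + j) - + 1                                ≡⟨ cong (λ z → + 1 + (+ toℕ b + z · + j) - + 1) (residue-split k q) ⟩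
      + 1 + (+ toℕ b + (+ toℕ a + q /ℕ k · + k) · + j) - + 1         ≡⟨ cancel (+ toℕ b) (+ j) (+ toℕ a) (q /ℕ k) (+ k) ⟩
      (+ j · + toℕ a + + toℕ b) + q /ℕ k · (+ k · + j)               ≡⟨ cong₂ (λ x y → (x + + toℕ b) + q /ℕ k · y) (pos-* j (toℕ a)) (pos-* k j) ⟨
      + (j ℕ.* toℕ a ℕ.+ toℕ b) + q /ℕ k · + (k ℕ.* j)               ≡⟨ cong (λ z → + z + q /ℕ k · + (k ℕ.* j)) (toℕ-combine a b) ⟨
      + toℕ (combine a b) + q /ℕ k · + (k ℕ.* j)                     ∎

    expand : ∀ a c k → - + 1 - a ≡ - + 1 - (a + c · k) + c · k
    expand = solve-∀

    colour : - + 1 - + toℕ a ≡ - + 1 - q + q /ℕ k · + k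
    colour = trans (expand (+ toℕ a) (q /ℕ k) (+ k)) (cong (λ z → - + 1 - z + q /ℕ k · + k) (sym (residue-split k q)))

  module _ {l} (p : Word (suc l)) where

    ρ-symbol-lookup : ∀ (x : Fin (k ℕ.* suc l)) → ρ-symbol p (+ suc (toℕ x)) ≡ lookup (ρ p) x
    ρ-symbol-lookup x = cong (lookup (ρ p)) (residue-unique (k ℕ.* suc l) {{ℕ.m*n≢0 k (suc l)}} x (+ 0) (cancel (+ toℕ x)))
      where
      cancel : ∀ x → + 1 + x - + 1 ≡ x + + 0
      cancel = solve-∀

    -- Going back by j turns q into q - 1 in i = 1 + b + qj, and so raises the shift -1 - q by one.
    ρ-symbol-shift : ∀ i → ρ-symbol p (i - + suc l) ≡ ρ-symbol p i ⁺ˢ (+ 1)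
    ρ-symbol-shift i = begin
      ρ-symbol p (i - + suc l)                  ≡⟨ ρ-symbol-≡ p b (q - + 1) earlier ⟩
      lookup p b ⁺ˢ (- + 1 - (q - + 1))         ≡⟨ cong (lookup p b ⁺ˢ_) (assoc q) ⟩
      lookup p b ⁺ˢ (- + 1 - q + + 1)           ≡⟨ ⁺ˢ-⁺ˢ (lookup p b) (- + 1 - q) (+ 1) ⟨
      lookup p b ⁺ˢ (- + 1 - q) ⁺ˢ (+ 1)          ≡⟨ cong (_⁺ˢ (+ 1)) (ρ-symbol-≡ p b q position) ⟨
      ρ-symbol p i ⁺ˢ (+ 1)                       ∎
      where
      b : Fin (suc l)
      b = residue (i - + 1) (suc l)
      q : ℤ
      q = (i - + 1) /ℕ suc l
      assoc : ∀ q → - + 1 - (q - + 1) ≡ - + 1 - q + + 1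
      assoc = solve-∀
      cancel : ∀ i → i ≡ + 1 + (i - + 1)
      cancel = solve-∀
      position : i ≡ + 1 + (+ toℕ b + q · + suc l)
      position = trans (cancel i) (cong (λ z → + 1 + z) (residue-split (suc l) (i - + 1)))
      shift : ∀ b q j → + 1 + (b + q · j) - j ≡ + 1 + (b + (q - + 1) · j)
      shift = solve-∀
      earlier : i - + suc l ≡ + 1 + (+ toℕ b + (q - + 1) · + suc l)
      earlier = trans (cong (λ z → z - + suc l) position) (shift (+ toℕ b) q (+ suc l))

    -- r_{i-j+1} ⋯ r_i
    ρ-factor : ℤ → Word (suc l)
    ρ-factor i = ρ-window p i ∷ʳ ρ-symbol p i

    ρ-factor-tabulate : ∀ i → ρ-factor i ≡ tabulate (λ t → ρ-symbol p (i - + suc l + + 1 + + toℕ t))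
    ρ-factor-tabulate i = sym (trans (tabulate-∷ʳ λ t → ρ-symbol p (i - + suc l + + 1 + + toℕ t)) (cong₂ _∷ʳ_
      (tabulate-cong λ t → cong (λ z → ρ-symbol p (i - + suc l + + 1 + + z)) (toℕ-inject₁ t))
      (cong (ρ-symbol p) (trans (cong (λ z → i - + suc l + + 1 + + z) (toℕ-fromℕ l)) (end i (+ l))))))
      where
      end : ∀ i l → i - (+ 1 + l) + + 1 + l ≡ i
      end = solve-∀

    -- The first index i - j + 1 equals (i + 1) - j, one copy behind r_{i+1}; the remaining indices
    -- are those of the window before r_{i+1}. This relates the start of block i to block i + 1.
    ρ-factor-pred : ∀ i → ρ-factor (+ i) ≡ (ρ-symbol p (+ suc i) ⁺ˢ (+ 1)) ∷ ρ-window p (+ suc i)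
    ρ-factor-pred i = trans (ρ-factor-tabulate (+ i)) (cong₂ _∷_
      (trans (cong (ρ-symbol p) (first (+ i) (+ suc l))) (ρ-symbol-shift (+ suc i)))
      (tabulate-cong λ t → cong (ρ-symbol p) (rest (+ i) (+ suc l) (+ toℕ t))))
      where
      first : ∀ i j → i - j + + 1 + + 0 ≡ + 1 + i - j
      first = solve-∀
      rest : ∀ i j t → i - j + + 1 + (+ 1 + t) ≡ + 1 + i - j + + 1 + t
      rest = solve-∀

    -- Here q = ck - 1, so the shift is -ck, which is zero modulo k. The case c = 1 identifies the
    -- first entry of `𝒞 p`; the case c = 0 identifies the last one and starts the induction on
    -- values.
    ρ-factor-multiple : ∀ c {i} → i ≡ c · (+ k · + suc l) → ρ-factor i ≡ p
    ρ-factor-multiple c {i} i≡ = begin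
      ρ-factor i                                                     ≡⟨ ρ-factor-tabulate i ⟩
      tabulate (λ t → ρ-symbol p (i - + suc l + + 1 + + toℕ t))      ≡⟨ tabulate-cong at ⟩
      tabulate (lookup p)                                            ≡⟨ tabulate∘lookup p ⟩
      p                                                              ∎
      where
      index : ∀ c k j t → c · (k · j) - j + + 1 + t ≡ + 1 + (t + (c · k - + 1) · j)
      index = solve-∀
      colour : ∀ c k → - + 1 - (c · k - + 1) ≡ + 0 + (- c) · k
      colour = solve-∀
      at : ∀ t → ρ-symbol p (i - + suc l + + 1 + + toℕ t) ≡ lookup p t
      at t = begin
        ρ-symbol p (i - + suc l + + 1 + + toℕ t)   ≡⟨ ρ-symbol-≡ p t (c · + k - + 1) (trans (cong (λ z → z - + suc l + + 1 + + toℕ t) i≡) (index c (+ k) (+ suc l) (+ toℕ t))) ⟩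
        lookup p t ⁺ˢ (- + 1 - (c · + k - + 1))    ≡⟨ ⁺ˢ-cong (lookup p t) (+ 0) (- c) (colour c (+ k)) ⟩
        lookup p t ⁺ˢ (+ 0)                          ≡⟨ ⁺ˢ-0 (lookup p t) ⟩
        lookup p t                                 ∎

  -- Flips and the word that flips to a given one.

  ⁺-inverse : ∀ {j} (p : Word j) → p ⁺ (- + 1) ⁺ (+ 1) ≡ p
  ⁺-inverse p = trans (sym (map-∘ _ _ p)) (trans (map-cong (λ x → trans (⁺ˢ-⁺ˢ x (- + 1) (+ 1)) (⁺ˢ-0 x)) p) (map-id p))

  toList-flip : ∀ {j} i (i≤j : i ≤ j) (p : Word j) →
                toList (flip i i≤j p) ≡ map (_⁺ˢ (+ 1)) (List.reverse (List.take i (toList p))) ++ List.drop i (toList p)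
  toList-flip {j} i i≤j p = begin
    toList (flip i i≤j p)                                                                ≡⟨ toList-cast _ (reverse (Vec.take i p′) ⁺ (+ 1) Vec.++ Vec.drop i p′) ⟩
    toList (reverse (Vec.take i p′) ⁺ (+ 1) Vec.++ Vec.drop i p′)                        ≡⟨ toList-++ (reverse (Vec.take i p′) ⁺ (+ 1)) _ ⟩
    toList (reverse (Vec.take i p′) ⁺ (+ 1)) ++ toList (Vec.drop i p′)                   ≡⟨ cong₂ _++_ front back ⟩
    map (_⁺ˢ (+ 1)) (List.reverse (List.take i (toList p))) ++ List.drop i (toList p)    ∎
    where
    p′ : Word (i ℕ.+ (j ℕ.∸ i))
    p′ = Vec.cast (sym (ℕ.m+[n∸m]≡n i≤j)) p

    front : toList (reverse (Vec.take i p′) ⁺ (+ 1)) ≡ map (_⁺ˢ (+ 1)) (List.reverse (List.take i (toList p)))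
    front = begin
      toList (reverse (Vec.take i p′) ⁺ (+ 1))                       ≡⟨ toList-map _ (reverse (Vec.take i p′)) ⟩
      map (_⁺ˢ (+ 1)) (toList (reverse (Vec.take i p′)))             ≡⟨ cong (map _) (toList-reverse (Vec.take i p′)) ⟩
      map (_⁺ˢ (+ 1)) (List.reverse (toList (Vec.take i p′)))        ≡⟨ cong (map _ ∘ List.reverse) (toList-take i p′) ⟩
      map (_⁺ˢ (+ 1)) (List.reverse (List.take i (toList p′)))       ≡⟨ cong (map _ ∘ List.reverse ∘ List.take i) (toList-cast _ p) ⟩
      map (_⁺ˢ (+ 1)) (List.reverse (List.take i (toList p)))        ∎

    back : toList (Vec.drop i p′) ≡ List.drop i (toList p)
    back = trans (toList-drop i p′) (cong (List.drop i) (toList-cast _ p))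

  flip-all : ∀ {j} (p : Word j) → flip j ≤-refl p ≡ reverse p ⁺ (+ 1)
  flip-all {j} p = vec-≡ (begin
    toList (flip j ≤-refl p)                                                             ≡⟨ toList-flip j ≤-refl p ⟩
    map (_⁺ˢ (+ 1)) (List.reverse (List.take j (toList p))) ++ List.drop j (toList p)    ≡⟨ cong₂ (λ xs ys → map _ (List.reverse xs) ++ ys)
                                                                                              (List.take-all j (toList p) short) (List.drop-all j (toList p) short) ⟩
    map (_⁺ˢ (+ 1)) (List.reverse (toList p)) ++ []                                      ≡⟨ List.++-identityʳ _ ⟩
    map (_⁺ˢ (+ 1)) (List.reverse (toList p))                                            ≡⟨ cong (map _) (toList-reverse p) ⟨
    map (_⁺ˢ (+ 1)) (toList (reverse p))                                                 ≡⟨ toList-map _ (reverse p) ⟨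
    toList (reverse p ⁺ (+ 1))                                                           ∎)
    where
    short : length (toList p) ≤ j
    short = ℕ.≤-reflexive (length-toList p)

  -- Since i ≤ j, both `take i` and `drop i` cut inside `p`, and the appended symbol stays behind
  -- the reversed prefix. Thus a flip path for a window lifts to a flip path through its block.
  flip-∷ʳ : ∀ {j} i (i≤j : i ≤ j) i≤1+j (p : Word j) x → flip i i≤j p ∷ʳ x ≡ flip i i≤1+j (p ∷ʳ x)
  flip-∷ʳ {j} i i≤j i≤1+j p x = vec-≡ (begin
    toList (flip i i≤j p ∷ʳ x)                           ≡⟨ toList-∷ʳ x (flip i i≤j p) ⟩
    toList (flip i i≤j p) ++ x ∷ []                      ≡⟨ cong (_++ x ∷ []) (toList-flip i i≤j p) ⟩
    (front (List.take i ps) ++ List.drop i ps) ++ x ∷ [] ≡⟨ List.++-assoc (front (List.take i ps)) (List.drop i ps) (x ∷ []) ⟩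
    front (List.take i ps) ++ List.drop i ps ++ x ∷ []   ≡⟨ cong₂ (λ xs ys → front xs ++ ys) (take-++-≤ ps long) (drop-++-≤ ps long) ⟨
    front (List.take i (ps ++ x ∷ [])) ++ List.drop i (ps ++ x ∷ [])
                                                         ≡⟨ cong (λ xs → front (List.take i xs) ++ List.drop i xs) (toList-∷ʳ x p) ⟨
    front (List.take i (toList (p ∷ʳ x))) ++ List.drop i (toList (p ∷ʳ x))
                                                         ≡⟨ toList-flip i i≤1+j (p ∷ʳ x) ⟨
    toList (flip i i≤1+j (p ∷ʳ x))                       ∎)
    where
    ps : List Symbol
    ps = toList p
    front : List Symbol → List Symbol
    front xs = map (_⁺ˢ (+ 1)) (List.reverse xs)
    long : i ≤ length ps
    long = subst (i ≤_) (sym (length-toList p)) i≤j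

  FlipStep-∷ʳ : ∀ {j} x {p q : Word j} → FlipStep p q → FlipStep (p ∷ʳ x) (q ∷ʳ x)
  FlipStep-∷ʳ x {p} (i , 1≤i , i≤j , refl) = i , 1≤i , ℕ.m≤n⇒m≤1+n i≤j , flip-∷ʳ i i≤j (ℕ.m≤n⇒m≤1+n i≤j) p x

  -- The preimage of `p` under the full flip; it turns out to be the last entry of `𝒞 p`.
  unflip : ∀ {j} → Word j → Word j
  unflip p = reverse (p ⁺ (- + 1))

  flip-unflip : ∀ {j} (p : Word j) → flip j ≤-refl (unflip p) ≡ p
  flip-unflip p = trans (flip-all (unflip p)) (trans (cong (_⁺ (+ 1)) (reverse-involutive (p ⁺ (- + 1)))) (⁺-inverse p))

  unflip-∷ : ∀ {j} x (p : Word j) → unflip ((x ⁺ˢ (+ 1)) ∷ p) ≡ unflip p ∷ʳ x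
  unflip-∷ x p = trans (reverse-∷ _ (p ⁺ (- + 1))) (cong (unflip p ∷ʳ_) (trans (⁺ˢ-⁺ˢ x (+ 1) (- + 1)) (⁺ˢ-0 x)))

  unflip-step : ∀ {l} (p : Word (suc l)) → FlipStep (unflip p) p
  unflip-step {l} p = suc l , s≤s z≤n , ≤-refl , sym (flip-unflip p)

  -- On the left is the word that flips to the start of block i, on the right the end of block i +
  -- 1. Their equality makes consecutive blocks differ by a full flip.
  ρ-factor-unflip : ∀ {l} (p : Word (suc l)) i →
                    unflip (ρ-factor p (+ i)) ≡ unflip (ρ-window p (+ suc i)) ∷ʳ ρ-symbol p (+ suc i)
  ρ-factor-unflip p i = trans (cong unflip (ρ-factor-pred p i)) (unflip-∷ (ρ-symbol p (+ suc i)) (ρ-window p (+ suc i)))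

  -- The list `𝒞 p` as a path of flips.

  block : ∀ {l} → Word (suc (suc l)) → ℕ → List (Word (suc (suc l)))
  block p i = map (_∷ʳ ρ-symbol p (+ i)) (𝒞 (ρ-window p (+ i)))

  -- The exact end `unflip p` is part of the induction hypothesis, because the ends of the window
  -- paths decide whether the blocks join.
  𝒞-path : ∀ {l} (p : Word (suc l)) → Path FlipStep p (𝒞 p) (unflip p)
  𝒞-path {zero} (x ∷ []) = path-endpoints (⁺-0 x) lastEntry (cycle k)
    where
    ⁺-0 : ∀ x → (x ∷ []) ⁺ (+ 0) ≡ x ∷ []
    ⁺-0 x = cong (_∷ []) (⁺ˢ-0 x)
    step : ∀ i → FlipStep ((x ∷ []) ⁺ (+ i)) ((x ∷ []) ⁺ (+ suc i))
    step i = 1 , s≤s z≤n , ≤-refl , sym (trans (flip-all ((x ∷ []) ⁺ (+ i)))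
      (cong (_∷ []) (trans (⁺ˢ-⁺ˢ x (+ i) (+ 1)) (cong (λ z → x ⁺ˢ (+ z)) (ℕ.+-comm i 1)))))
    -- The number of shifts is generalised from `k` to a nonzero `m` so that it can be written as a
    -- successor.
    cycle : ∀ m .{{_ : NonZero m}} →
            Path FlipStep ((x ∷ []) ⁺ (+ 0)) (map (λ s → (x ∷ []) ⁺ (+ s)) (upTo m)) ((x ∷ []) ⁺ (+ (ℕ.pred m)))
    cycle (suc m) = path-applyUpTo (λ s → (x ∷ []) ⁺ (+ s)) id step m
    pred-mod : ∀ m .{{_ : NonZero m}} → + ℕ.pred m ≡ - + 1 + + 1 · + m
    pred-mod (suc m) = cancel (+ m)
      where
      cancel : ∀ m → m ≡ - + 1 + + 1 · (+ 1 + m)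
      cancel = solve-∀
    -- The last shift k - 1 is congruent to the shift -1 in `unflip`, and reversing one symbol
    -- changes nothing.
    lastEntry : (x ∷ []) ⁺ (+ ℕ.pred k) ≡ unflip (x ∷ [])
    lastEntry = cong (_∷ []) (⁺ˢ-cong x (- + 1) (+ 1) (pred-mod k))
  𝒞-path {suc l} p = path-endpoints (ρ-factor-multiple p (+ 1) size) lastEntry
    (path-downFrom
      (block p)
      (λ i → ρ-factor p (+ i))
      (λ i → unflip (ρ-window p (+ i)) ∷ʳ ρ-symbol p (+ i))
      (λ i → path-map (_∷ʳ ρ-symbol p (+ i)) (FlipStep-∷ʳ (ρ-symbol p (+ i))) (𝒞-path (ρ-window p (+ i))))
      (λ i → subst (λ q → FlipStep q (ρ-factor p (+ i))) (ρ-factor-unflip p i) (unflip-step (ρ-factor p (+ i))))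
      (k * suc (suc l)) {{ℕ.m*n≢0 k (suc (suc l))}})
    where
    size : + (k * suc (suc l)) ≡ + 1 · (+ k · + suc (suc l))
    size = trans (pos-* k (suc (suc l))) (sym (*-identityˡ (+ k · + suc (suc l))))
    -- A full flip of the end of block 1 gives the factor ending at r_0, which is `p` again: the
    -- list closes up cyclically.
    lastEntry : unflip (ρ-window p (+ 1)) ∷ʳ ρ-symbol p (+ 1) ≡ unflip p
    lastEntry = trans (sym (ρ-factor-unflip p 0)) (cong unflip (ρ-factor-multiple p (+ 0) refl))

  -- The entries of `𝒞 p` are the words with the values of `p`.

  -- Being a coloured permutation does not pass to windows, which carry fewer values. The induction
  -- therefore compares value lists up to `↭`.
  values : ∀ {j} → Word j → List (Fin n)
  values p = toList (Vec.map proj₁ p)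

  values-∷ʳ : ∀ {j} (p : Word j) x → values (p ∷ʳ x) ↭ proj₁ x ∷ values p
  values-∷ʳ p x = ↭-trans
    (↭-reflexive (trans (cong toList (map-∷ʳ proj₁ x p)) (toList-∷ʳ (proj₁ x) (Vec.map proj₁ p))))
    (↭-sym (∷↭∷ʳ (proj₁ x) (values p)))

  -- The factors ending at i and i + 1 share the window before r_{i+1}; one has r_{i+1}^{+1} in
  -- front of it, the other r_{i+1} behind it. Hence the values do not change with i, and at i = 0
  -- the factor is `p`.
  ρ-factor-values : ∀ {l} (p : Word (suc l)) i → values (ρ-factor p (+ i)) ↭ values p
  ρ-window-values : ∀ {l} (p : Word (suc l)) i → proj₁ (ρ-symbol p (+ suc i)) ∷ values (ρ-window p (+ suc i)) ↭ values p

  ρ-factor-values p zero    = ↭-reflexive (cong values (ρ-factor-multiple p (+ 0) refl))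
  ρ-factor-values p (suc i) = ↭-trans (values-∷ʳ (ρ-window p (+ suc i)) (ρ-symbol p (+ suc i))) (ρ-window-values p i)

  ρ-window-values p i = ↭-trans (↭-reflexive (cong values (sym (ρ-factor-pred p i)))) (ρ-factor-values p i)

  ∈-𝒞⇒values : ∀ {l} (p : Word (suc l)) {σ} → σ ∈ 𝒞 p → values σ ↭ values p
  ∈-𝒞⇒values {zero} (x ∷ []) σ∈ with s , _ , refl ← ∈-map⁻ (λ s → (x ∷ []) ⁺ (+ s)) σ∈ = ↭-refl
  ∈-𝒞⇒values {suc l} p σ∈
    with _ , i∈ , σ∈block ← find (∈-concatMap⁻ (block p) {xs = map suc (downFrom (k * suc (suc l)))} σ∈)
    with i , _ , refl ← ∈-map⁻ suc i∈
    with τ , τ∈ , refl ← ∈-map⁻ (_∷ʳ ρ-symbol p (+ suc i)) σ∈block =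
    ↭-trans (values-∷ʳ τ (ρ-symbol p (+ suc i)))
      (↭-trans (prep _ (∈-𝒞⇒values (ρ-window p (+ suc i)) τ∈)) (ρ-window-values p i))

  -- s ↦ −1−s is an involution modulo k.
  residue-reflect : ∀ s → - + 1 - + toℕ (residue (- + 1 - s) k) ≡ s + (- + 1 - s) /ℕ k · + k
  residue-reflect s = begin
    - + 1 - r                                   ≡⟨ expand s r ⟩
    s + ((- + 1 - s) - r)                       ≡⟨ cong (λ z → s + (z - r)) (residue-split k (- + 1 - s)) ⟩
    s + (r + (- + 1 - s) /ℕ k · + k - r)        ≡⟨ cancel s r ((- + 1 - s) /ℕ k · + k) ⟩
    s + (- + 1 - s) /ℕ k · + k                  ∎
    where
    r : ℤ
    r = + toℕ (residue (- + 1 - s) k)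
    expand : ∀ s r → - + 1 - r ≡ s + ((- + 1 - s) - r)
    expand = solve-∀
    cancel : ∀ s r z → s + (r + z - r) ≡ s + z
    cancel = solve-∀

  ρ-surjective : ∀ {j} (p : Word j) y → proj₁ y ∈ values p → ∃[ x ] lookup (ρ p) x ≡ y
  ρ-surjective {j} p y y∈ = combine a b , (begin
    lookup (ρ p) (combine a b)             ≡⟨ lookup-ρ p a b ⟩
    lookup p b ⁺ˢ (- + 1 - + toℕ a)        ≡⟨ ⁺ˢ-cong (lookup p b) s ((- + 1 - s) /ℕ k) (residue-reflect s) ⟩
    lookup p b ⁺ˢ s                        ≡⟨ proj₂ same ⟨
    y                                      ∎)
    where
    b : Fin j
    b = VecAny.index (∈-toList⁻ y∈)
    same : ∃[ s ] y ≡ lookup p b ⁺ˢ s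
    same = ⁺ˢ-connects (lookup p b) y (sym (trans (lookup-index (∈-toList⁻ y∈)) (lookup-map b proj₁ p)))
    s : ℤ
    s = proj₁ same
    -- Copy a carries the shift -1 - a, so the shift s calls for a = -1 - s modulo k.
    a : Fin k
    a = residue (- + 1 - s) k

  ∈-block⇒∈-𝒞 : ∀ {l} (p : Word (suc (suc l))) (x : Fin (k * suc (suc l))) {σ} → σ ∈ block p (suc (toℕ x)) → σ ∈ 𝒞 p
  ∈-block⇒∈-𝒞 {l} p x σ∈ =
    ∈-concatMap⁺ (block p) {xs = map suc (downFrom (k * suc (suc l)))} (lose (∈-map⁺ suc (∈-downFrom⁺ (toℕ<n x))) σ∈)

  values⇒∈-𝒞 : ∀ {l} (p : Word (suc l)) {σ} → values σ ↭ values p → σ ∈ 𝒞 p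
  values⇒∈-𝒞 {zero} (x ∷ []) {y ∷ []} eq =
    -- The integer shift s may be negative, while the list has the shifts 0, ..., k - 1; s is
    -- replaced by its residue.
    subst (_∈ 𝒞 (x ∷ [])) (cong (_∷ []) (sym (trans (proj₂ same) (⁺ˢ-cong x (+ toℕ (residue s k)) (s /ℕ k) (residue-split k s)))))
      (∈-map⁺ (λ s → (x ∷ []) ⁺ (+ s)) (∈-upTo⁺ (toℕ<n (residue s k))))
    where
    same : ∃[ s ] y ≡ x ⁺ˢ s
    same = ⁺ˢ-connects x y (sym (List.∷-injectiveˡ (↭-singleton-inv eq)))
    s : ℤ
    s = proj₁ same
  values⇒∈-𝒞 {suc l} p {σ} eq = subst (_∈ 𝒞 p) σ≡ (∈-block⇒∈-𝒞 p x
    (∈-map⁺ (_∷ʳ ρ-symbol p (+ i)) (values⇒∈-𝒞 (ρ-window p (+ i)) rest)))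
    where
    τ : Word (suc l)
    τ = proj₁ (Vec.initLast σ)
    y : Symbol
    y = proj₁ (proj₂ (Vec.initLast σ))
    σ-values : proj₁ y ∷ values τ ↭ values p
    σ-values = ↭-trans (↭-sym (values-∷ʳ τ y)) (subst (λ σ → values σ ↭ values p) (proj₂ (proj₂ (Vec.initLast σ))) eq)
    found : ∃[ x ] lookup (ρ p) x ≡ y
    found = ρ-surjective p y (∈-resp-↭ σ-values (here refl))
    x : Fin (k * suc (suc l))
    x = proj₁ found
    i : ℕ
    i = suc (toℕ x)
    y≡ : ρ-symbol p (+ i) ≡ y
    y≡ = trans (ρ-symbol-lookup p x) (proj₂ found)
    σ≡ : τ ∷ʳ ρ-symbol p (+ i) ≡ σ
    σ≡ = trans (cong (τ ∷ʳ_) y≡) (sym (proj₂ (proj₂ (Vec.initLast σ))))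
    -- Both lists become permutations of `values p` once the value of the last symbol is put in
    -- front, and this value cancels.
    rest : values τ ↭ values (ρ-window p (+ i))
    rest = drop-∷ (↭-trans σ-values
      (↭-sym (subst (λ z → proj₁ z ∷ values (ρ-window p (+ i)) ↭ values p) y≡ (ρ-window-values p (toℕ x)))))

  -- No entry occurs twice.

  -- Equal symbols have equal values, which forces the same position in `p`. Then -1 - a and -1 - a′
  -- agree modulo k, and reflecting both gives a = a′.
  ρ-injective : ∀ {j} (p : Word j) → Unique (values p) → Injective _≡_ _≡_ (lookup (ρ p))
  ρ-injective {j} p u {x} {y} eq
    with a , b , refl ← combine-surjective {k} {j} x
    with a′ , b′ , refl ← combine-surjective {k} {j} y = same-copy b b′ a a′ (same-position b b′ a a′ symbols) symbols
    where
    symbols : lookup p b ⁺ˢ (- + 1 - + toℕ a) ≡ lookup p b′ ⁺ˢ (- + 1 - + toℕ a′)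
    symbols = trans (sym (lookup-ρ p a b)) (trans eq (lookup-ρ p a′ b′))

    same-position : ∀ b b′ a a′ → lookup p b ⁺ˢ (- + 1 - + toℕ a) ≡ lookup p b′ ⁺ˢ (- + 1 - + toℕ a′) → b ≡ b′
    same-position b b′ a a′ eq = unique⇒lookup-injective (Vec.map proj₁ p) u
      (trans (lookup-map b proj₁ p) (trans (cong proj₁ eq) (sym (lookup-map b′ proj₁ p))))

    reflect : ∀ a → residue (- + 1 - + toℕ (residue (- + 1 - + toℕ a) k)) k ≡ a
    reflect a = residue-unique k a ((- + 1 - + toℕ a) /ℕ k) (residue-reflect (+ toℕ a))

    same-copy : ∀ b b′ a a′ → b ≡ b′ → lookup p b ⁺ˢ (- + 1 - + toℕ a) ≡ lookup p b′ ⁺ˢ (- + 1 - + toℕ a′) →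
                combine a b ≡ combine a′ b′
    same-copy b b a a′ refl eq = cong (λ c → combine c b) (begin
      a                                                              ≡⟨ reflect a ⟨
      residue (- + 1 - + toℕ (residue (- + 1 - + toℕ a) k)) k        ≡⟨ cong (λ r → residue (- + 1 - + toℕ r) k) (⁺ˢ-injective (lookup p b) (- + 1 - + toℕ a) (- + 1 - + toℕ a′) eq) ⟩
      residue (- + 1 - + toℕ (residue (- + 1 - + toℕ a′) k)) k       ≡⟨ reflect a′ ⟩
      a′                                                             ∎)

  ρ-symbol-injective : ∀ {l} (p : Word (suc l)) → Unique (values p) → ∀ {i j} → i ℕ.< k * suc l → j ℕ.< k * suc l →
                       ρ-symbol p (+ suc i) ≡ ρ-symbol p (+ suc j) → i ≡ j
  ρ-symbol-injective p u i< j< eq = trans (sym (toℕ-fromℕ< i<)) (trans (cong toℕ (ρ-injective p u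
    (trans (sym (at i<)) (trans eq (at j<))))) (toℕ-fromℕ< j<))
    where
    at : ∀ {i} (i< : i ℕ.< _) → ρ-symbol p (+ suc i) ≡ lookup (ρ p) (fromℕ< i<)
    at i< = trans (cong (λ z → ρ-symbol p (+ suc z)) (sym (toℕ-fromℕ< i<))) (ρ-symbol-lookup p (fromℕ< i<))

  𝒞-unique : ∀ {l} (p : Word (suc l)) → Unique (values p) → Unique (𝒞 p)
  𝒞-unique {zero} (x ∷ []) _ = AllPairs.map⁺ (AllPairs.applyUpTo⁺₁ id k λ {i} {j} i<j j<k eq →
    -- Equal entries would have shifts congruent modulo k, yet both shifts are less than k.
    ℕ.<⇒≢ i<j (trans (sym (small (ℕ.<-trans i<j j<k))) (trans
      (cong toℕ (⁺ˢ-injective x (+ i) (+ j) (proj₁ (∷-injective eq)))) (small j<k))))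
    where
    small : ∀ {i} → i ℕ.< k → toℕ (residue (+ i) k) ≡ i
    small {i} i<k = trans (cong toℕ (residue-unique k (fromℕ< i<k) (+ 0)
      (cong +_ (sym (trans (ℕ.+-identityʳ _) (toℕ-fromℕ< i<k)))))) (toℕ-fromℕ< i<k)
  𝒞-unique {suc l} p u = Unique.concat⁺
    (All.map⁺ (All.map⁺ (All.applyDownFrom⁺₂ id m λ i →
      Unique.map⁺ (∷ʳ-injectiveˡ _ _) (𝒞-unique (ρ-window p (+ suc i)) (window-unique i)))))
    (AllPairs.map⁺ (AllPairs.map⁺ (AllPairs.applyDownFrom⁺₁ id m disjoint)))
    where
    m : ℕ
    m = k * suc (suc l)

    window-unique : ∀ i → Unique (values (ρ-window p (+ suc i)))
    window-unique i = tail (Unique-resp-↭ (setoid _) (↭⇒↭ₛ (↭-sym (ρ-window-values p i))) u)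

    last-symbol : ∀ i {σ} → σ ∈ block p i → ∃[ τ ] σ ≡ τ ∷ʳ ρ-symbol p (+ i)
    last-symbol i σ∈ = let τ , _ , eq = ∈-map⁻ (_∷ʳ ρ-symbol p (+ i)) σ∈ in τ , eq

    -- A common entry would end both in r_{i+1} and in r_{j+1}, two different symbols within one
    -- turn of the circle.
    disjoint : ∀ {i j} → j ℕ.< i → i ℕ.< m → Disjoint (block p (suc i)) (block p (suc j))
    disjoint {i} {j} j<i i<m (∈i , ∈j) =
      let τ  , eq  = last-symbol (suc i) ∈i
          τ′ , eq′ = last-symbol (suc j) ∈j
      in ℕ.<⇒≢ j<i (ρ-symbol-injective p u (ℕ.<-trans j<i i<m) i<m
           (sym (proj₂ (∷ʳ-injective τ τ′ (trans (sym eq) eq′)))))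

  -- The number of entries.

  𝒞-length : ∀ {l} (p : Word (suc l)) → length (𝒞 p) ≡ k ^ suc l * suc l !
  𝒞-length {zero} p = trans (List.length-map (λ s → p ⁺ (+ s)) (upTo k)) (trans (List.length-upTo k) (units k))
    where
    units : ∀ k → k ≡ k * 1 * 1
    units = ℕ.solve-∀
  𝒞-length {suc l} p = begin
    length (𝒞 p)                                            ≡⟨ length-concatMap-const (block p) block-length indices ⟩
    length indices * (k ^ suc l * suc l !)                  ≡⟨ cong (_* (k ^ suc l * suc l !)) (trans (List.length-map suc (downFrom m)) (List.length-downFrom m)) ⟩
    k * suc (suc l) * (k ^ suc l * suc l !)                 ≡⟨ rearrange k (suc (suc l)) (k ^ suc l) (suc l !) ⟩
    k ^ suc (suc l) * suc (suc l) !                         ∎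
    where
    m : ℕ
    m = k * suc (suc l)
    indices : List ℕ
    indices = map suc (downFrom m)
    block-length : ∀ i → length (block p i) ≡ k ^ suc l * suc l !
    block-length i = trans (List.length-map (_∷ʳ ρ-symbol p (+ i)) (𝒞 (ρ-window p (+ i)))) (𝒞-length (ρ-window p (+ i)))
    rearrange : ∀ k j x y → k * j * (x * y) ≡ k * x * (j * y)
    rearrange = ℕ.solve-∀

  -- Coloured permutations and the theorem.

  perm⇒unique : ∀ {σ} → IsColouredPerm σ → Unique (values σ)
  perm⇒unique {σ} (inj , _) = lookup-injective⇒unique (Vec.map proj₁ σ) inj

  perm⇒complete : ∀ {σ} → IsColouredPerm σ → ∀ v → v ∈ values σ
  perm⇒complete {σ} (_ , surj) v with i , at ← surj v =
    subst (_∈ values σ) (at refl) (∈-toList⁺ (∈-lookup i (Vec.map proj₁ σ)))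

  -- Both value lists are free of repetitions and contain all of `Fin n`; such lists with the same
  -- elements are permutations of each other.
  perms⇒values : ∀ {σ π} → IsColouredPerm σ → IsColouredPerm π → values σ ↭ values π
  perms⇒values {σ} {π} Pσ Pπ = ∼bag⇒↭ (unique∧set⇒bag (perm⇒unique {σ} Pσ) (perm⇒unique {π} Pπ)
    (mk⇔ (λ _ → perm⇒complete {π} Pπ _) (λ _ → perm⇒complete {σ} Pσ _)))

  -- Absence of repetitions and completeness survive a permutation of the value list; they give
  -- injectivity and surjectivity of `lookup`.
  values⇒perm : ∀ {σ π} → values σ ↭ values π → IsColouredPerm π → IsColouredPerm σ
  values⇒perm {σ} {π} eq Pπ =
    unique⇒lookup-injective (Vec.map proj₁ σ) (Unique-resp-↭ (setoid _) (↭⇒↭ₛ (↭-sym eq)) (perm⇒unique {π} Pπ)) ,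
    λ v → let v∈ = ∈-toList⁻ (∈-resp-↭ (↭-sym eq) (perm⇒complete {π} Pπ v)) in
      VecAny.index v∈ , λ { refl → sym (lookup-index v∈) }

theorem3 : (n k : ℕ) .{{_ : NonZero n}} .{{_ : NonZero k}} →
    let open Coloured n k in
    (π : Word n) → IsColouredPerm π →
    (∀ σ → σ ∈ 𝒞 π ⇔ IsColouredPerm σ)
    × Unique (𝒞 π)
    × length (𝒞 π) ≡ k ^ n * n !
    × Linked FlipStep (𝒞 π)
    × (∃[ L ] last (𝒞 π) ≡ just L × head (𝒞 π) ≡ just (flip n ≤-refl L) × flip n ≤-refl L ≡ π)
theorem3 n@(suc _) k π Pπ =
  (λ σ → mk⇔ (λ σ∈ → values⇒perm n k {σ} {π} (∈-𝒞⇒values n k π σ∈) Pπ)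
             (λ Pσ → values⇒∈-𝒞 n k π (perms⇒values n k {σ} {π} Pσ Pπ))) ,
  𝒞-unique n k π (perm⇒unique n k {π} Pπ) ,
  𝒞-length n k π ,
  path-linked path ,
  unflip n k π , path-last path ,
  -- The head is `π` itself, rewritten as the full flip of the last entry.
  trans (path-head path) (cong just (sym (flip-unflip n k π))) ,
  flip-unflip n k π
  where
  open Coloured n k
  path : Path FlipStep π (𝒞 π) (unflip n k π)
  path = 𝒞-path n k π
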